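{- Let $D$ be an oriented graph and let $u$ be a vertex of $D$ of maximum score. Then every vertex $v \neq u$ of $D$ is weakly reachable within two steps from $u$.
   Context: An oriented graph is a digraph with no loops and no pair of symmetric arcs. For vertices $u,v$ write $u(1\text{ - }0)v$ if there is an arc from $u$ to $v$, $u(0\text{ - }1)v$ if there is an arc from $v$ to $u$, and $u(0\text{ - }0)v$ if there is no arc between $u$ and $v$. If $D$ has $n$ vertices, the score of a vertex $v$ is $s(v) = n-1+d^+(v)-d^-(v)$, where $d^+(v), d^-(v)$ are the out- and indegree of $v$; equivalently $s(v)=2d^+(v)+d^*(v)$ where $d^*(v)$ is the number of vertices $w$ with $v(0\text{ - }0)w$. A vertex $v$ is weakly reachable within two steps from $u$ if $u(1\text{ - }0)v$, or $u(0\text{ - }0)v$, or for some vertex $w$ one has $u(1\text{ - }0)w(1\text{ - }0)v$, or $u(1\text{ - }0)w(0\text{ - }0)v$, or $u(0\text{ - }0)w(1\text{ - }0)v$. -}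

module Defs where

open import Data.Fin.Base using (Fin)
open import Data.Integer.Base as ℤ using (ℤ; +_)
open import Data.List.Base using (length; filter; allFin)
open import Data.Nat.Base using (ℕ)
open import Data.Product.Base using (∃-syntax; _×_)
open import Data.Sum.Base using (_⊎_)
open import Level using (0ℓ)
open import Relation.Binary.Core using (Rel)
open import Relation.Binary.Definitions using (Decidable; Irreflexive; Asymmetric)
open import Relation.Binary.PropositionalEquality.Core using (_≡_; _≢_)
open import Relation.Nullary.Negation.Core using (¬_)

-- Decidability of arcs is what makes degrees computable; classically it is
-- no restriction.
record OrientedGraph (n : ℕ) : Set₁ where
  infix 4 _⟨1-0⟩_ _⟨0-1⟩_ _⟨0-0⟩_ _⟨1-0⟩?_

  field
    _⟨1-0⟩_  : Rel (Fin n) 0ℓ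
    _⟨1-0⟩?_ : Decidable _⟨1-0⟩_
    loopless : Irreflexive _≡_ _⟨1-0⟩_
    oriented : Asymmetric _⟨1-0⟩_

  _⟨0-1⟩_ : Rel (Fin n) 0ℓ
  u ⟨0-1⟩ v = v ⟨1-0⟩ u

  -- Relates distinct vertices only, so that every ordered pair of distinct
  -- vertices is of exactly one of the three kinds and the number of w with
  -- v ⟨0-0⟩ w is n - 1 - d⁺ v - d⁻ v.
  _⟨0-0⟩_ : Rel (Fin n) 0ℓ
  u ⟨0-0⟩ v = u ≢ v × ¬ (u ⟨1-0⟩ v) × ¬ (u ⟨0-1⟩ v)

  d⁺ : Fin n → ℕ
  d⁺ v = length (filter (λ w → v ⟨1-0⟩? w) (allFin n))

  d⁻ : Fin n → ℕ
  d⁻ v = length (filter (λ w → w ⟨1-0⟩? v) (allFin n))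

  score : Fin n → ℤ
  score v = + n ℤ.- + 1 ℤ.+ + d⁺ v ℤ.- + d⁻ v

  HasMaximumScore : Fin n → Set
  HasMaximumScore u = ∀ w → score w ℤ.≤ score u

  WeaklyReachableWithinTwoSteps : (u v : Fin n) → Set
  WeaklyReachableWithinTwoSteps u v =
      u ⟨1-0⟩ v
    ⊎ u ⟨0-0⟩ v
    ⊎ (∃[ w ] ( (u ⟨1-0⟩ w × w ⟨1-0⟩ v)
              ⊎ (u ⟨1-0⟩ w × w ⟨0-0⟩ v)
              ⊎ (u ⟨0-0⟩ w × w ⟨1-0⟩ v)))

{-# OPTIONS --safe #-}

-- If v is not weakly reachable within two steps from u, then v beats u, every
-- vertex beaten by u is beaten by v, and every vertex beating v beats u.  So
-- d⁺ u < d⁺ v, since u itself is beaten by v but not by u, while d⁻ v ≤ d⁻ u;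
-- hence the score of v exceeds that of u.
module Submission where

open import Defs
open import Data.Nat.Base using (ℕ; _≤_; _<_)
open import Data.Nat.Properties using (≤∧≢⇒<)
open import Data.Fin.Base using (Fin)
open import Data.Fin.Properties using (_≟_; any?)
open import Data.Integer.Base as ℤ using (+_; +≤+; +<+)
import Data.Integer.Properties as ℤ
open import Data.List.Base using (length; filter; allFin)
open import Data.List.Membership.Propositional using (_∈_)
open import Data.List.Membership.Propositional.Properties using (∈-allFin; ∈-filter⁺; ∈-filter⁻)
open import Data.List.Relation.Binary.Pointwise using (Pointwise-≡⇒≡)
open import Data.List.Relation.Binary.Sublist.Propositional using (⊆-refl) renaming (_⊆_ to _⊑_)
open import Data.List.Relation.Binary.Sublist.Propositional.Properties using (filter⁺; length-mono-≤; to-≋)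
open import Data.Product.Base using (_,_; proj₂)
open import Data.Sum.Base using (inj₁; inj₂)
open import Level using (Level)
open import Relation.Binary.Definitions using () renaming (Decidable to Decidable₂)
open import Relation.Binary.PropositionalEquality.Core using (_≢_; refl; sym; subst)
open import Relation.Nullary.Decidable.Core using (¬?; _×-dec_; _⊎-dec_; decidable-stable)
open import Relation.Nullary.Negation.Core using (¬_)
open import Relation.Unary using (Pred; Decidable; _⊆_)

private
  variable
    a p q : Level
    A : Set a

module _ {P : Pred A p} {Q : Pred A q} (P? : Decidable P) (Q? : Decidable Q) (P⊆Q : P ⊆ Q) where

  -- Kept as a sublist relation rather than a bare inequality of lengths: a sublist as long as the
  -- whole list must equal it, which the strict comparison relies on.
  filter-⊑ : ∀ xs → filter P? xs ⊑ filter Q? xs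
  filter-⊑ xs = filter⁺ P? Q? (λ { refl → P⊆Q }) (⊆-refl {x = xs})

  length-filter-mono-≤ : ∀ xs → length (filter P? xs) ≤ length (filter Q? xs)
  length-filter-mono-≤ xs = length-mono-≤ (filter-⊑ xs)

  -- Were the lengths equal, the two filtered lists would coincide, so `x` would survive the filter
  -- by `P?`, against `¬ P x`.
  length-filter-mono-< : ∀ {x xs} → x ∈ xs → Q x → ¬ P x →
                         length (filter P? xs) < length (filter Q? xs)
  length-filter-mono-< {x} {xs} x∈xs Qx ¬Px = ≤∧≢⇒< (length-filter-mono-≤ xs) λ same-length →
    let same-filter = Pointwise-≡⇒≡ (to-≋ same-length (filter-⊑ xs))
        x∈filterP   = subst (x ∈_) (sym same-filter) (∈-filter⁺ Q? x∈xs Qx)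
    in ¬Px (proj₂ (∈-filter⁻ P? {xs = xs} x∈filterP))

module _ {n : ℕ} (D : OrientedGraph n) where
  open OrientedGraph D

  _⟨0-0⟩?_ : Decidable₂ _⟨0-0⟩_
  u ⟨0-0⟩? v = ¬? (u ≟ v) ×-dec ¬? (u ⟨1-0⟩? v) ×-dec ¬? (v ⟨1-0⟩? u)

  -- Makes the final argument by contradiction constructive; the search for a middle vertex is
  -- decidable because there are finitely many vertices.
  weaklyReachable? : Decidable₂ WeaklyReachableWithinTwoSteps
  weaklyReachable? u v =
    (u ⟨1-0⟩? v) ⊎-dec (u ⟨0-0⟩? v) ⊎-dec any? λ w →
      ((u ⟨1-0⟩? w) ×-dec (w ⟨1-0⟩? v)) ⊎-dec
      ((u ⟨1-0⟩? w) ×-dec (w ⟨0-0⟩? v)) ⊎-dec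
      ((u ⟨0-0⟩? w) ×-dec (w ⟨1-0⟩? v))

  -- Excluding `v ⟨1-0⟩ u` as well would make the pair `⟨0-0⟩`; decidability of arcs removes the
  -- double negation.
  remaining-kind : ∀ {u v} → u ≢ v → ¬ (u ⟨1-0⟩ v) → ¬ (u ⟨0-0⟩ v) → v ⟨1-0⟩ u
  remaining-kind {u} {v} u≢v ¬u→v ¬u-v =
    decidable-stable (v ⟨1-0⟩? u) λ ¬v→u → ¬u-v (u≢v , ¬u→v , ¬v→u)

  score-mono-< : ∀ {u v} → d⁺ u < d⁺ v → d⁻ v ≤ d⁻ u → score u ℤ.< score v
  score-mono-< d⁺< d⁻≤ =
    -- The score is a left-nested sum whose last summand is the negated indegree, so the strict gain
    -- comes from the outdegree alone.
    ℤ.+-mono-<-≤ (ℤ.+-monoʳ-< (+ n ℤ.- + 1) (+<+ d⁺<)) (ℤ.neg-mono-≤ (+≤+ d⁻≤))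

  module _ {u v : Fin n} (v≢u : v ≢ u) (¬reach : ¬ WeaklyReachableWithinTwoSteps u v) where

    unreachable⇒beats : v ⟨1-0⟩ u
    unreachable⇒beats = remaining-kind (λ u≡v → v≢u (sym u≡v))
      (λ u→v → ¬reach (inj₁ u→v))
      (λ u-v → ¬reach (inj₂ (inj₁ u-v)))

    -- With `u ⟨1-0⟩ w` as first step, either `w ⟨1-0⟩ v` or `w ⟨0-0⟩ v` would complete a permitted
    -- walk to `v`.
    unreachable⇒out-⊆ : ∀ {w} → u ⟨1-0⟩ w → v ⟨1-0⟩ w
    unreachable⇒out-⊆ {w} u→w = remaining-kind
      (λ { refl → ¬reach (inj₁ u→w) })
      (λ w→v → ¬reach (inj₂ (inj₂ (w , inj₁ (u→w , w→v)))))
      (λ w-v → ¬reach (inj₂ (inj₂ (w , inj₂ (inj₁ (u→w , w-v))))))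

    -- Dually, `w ⟨1-0⟩ v` is a permitted last step after either `u ⟨1-0⟩ w` or `u ⟨0-0⟩ w`.
    unreachable⇒in-⊆ : ∀ {w} → w ⟨1-0⟩ v → w ⟨1-0⟩ u
    unreachable⇒in-⊆ {w} w→v = remaining-kind
      (λ { refl → ¬reach (inj₁ w→v) })
      (λ u→w → ¬reach (inj₂ (inj₂ (w , inj₁ (u→w , w→v)))))
      (λ u-w → ¬reach (inj₂ (inj₂ (w , inj₂ (inj₂ (u-w , w→v))))))

    unreachable⇒score-< : score u ℤ.< score v
    unreachable⇒score-< = score-mono-<
      (length-filter-mono-< (u ⟨1-0⟩?_) (v ⟨1-0⟩?_) unreachable⇒out-⊆
        (∈-allFin u) unreachable⇒beats (loopless refl))
      (length-filter-mono-≤ (_⟨1-0⟩? v) (_⟨1-0⟩? u) unreachable⇒in-⊆ (allFin n))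

theorem4 : (n : ℕ) (D : OrientedGraph n) (u : Fin n) →
    OrientedGraph.HasMaximumScore D u →
    (v : Fin n) → v ≢ u →
    OrientedGraph.WeaklyReachableWithinTwoSteps D u v
theorem4 n D u u-max v v≢u = decidable-stable (weaklyReachable? D u v) λ ¬reach →
  ℤ.≤⇒≯ (u-max v) (unreachable⇒score-< D v≢u ¬reach)
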